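{- Let $N\ge2$ be even, $M_2=N/2$, and let $a$ be odd. The linear code over $\mathbb{Z}_N$ generated by the rows of $$g=\begin{pmatrix} M_2 & M_2 & 0 & 0 & 0 \\ {} M_2 & 0 & M_2 & 1 & -1 \\ 0 & 0 & 0 & a & -a \end{pmatrix}$$ is isomorphic to the code generated by the rows of $$g_0=\begin{pmatrix} M_2 & M_2 & 0 & 0 & 0 \\ {} M_2 & 0 & M_2 & 0 & 0 \\ 0 & 0 & 0 & 1 & -1 \end{pmatrix}.$$ This is a direct sum; in particular, the corresponding simplex is a free join of $2\Delta_2$ and a $1$-dimensional interval of length $N$.
   Context: $\mathbb{Z}_N=\mathbb{Z}/N\mathbb{Z}$. A linear code of length $n$ over $\mathbb{Z}_N$ is a submodule of $\mathbb{Z}_N^n$. Two codes over the same $\mathbb{Z}_N$ and of the same length are isomorphic if they coincide after a permutation of coordinates. Direct sum: for codes $C_1$ over $\mathbb{Z}_{N_1}$ and $C_2$ over $\mathbb{Z}_{N_2}$, with $L=\operatorname{lcm}(N_1,N_2)$, $C_1\oplus C_2$ is the code over $\mathbb{Z}_L$ consisting of all concatenations $\frac{L}{N_1}c_1\,|\,\frac{L}{N_2}c_2$, $c_i\in C_i$. Simplex of a code: for a code $C\subseteq\mathbb{Z}_N^{d+1}$ all of whose words have coordinate sum $0\bmod N$, let $M=\pi^{ -1}(C)\subseteq\mathbb{Z}^{d+1}$ with $\pi:\mathbb{Z}^{d+1}\to\mathbb{Z}_N^{d+1}$ the reduction map; the corresponding simplex is $\operatorname{conv}(Ne_0,\dots,Ne_d)$,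 viewed as a lattice simplex with respect to the affine lattice $\operatorname{aff}(Ne_0,\dots,Ne_d)\cap M$. Lattice simplices are considered up to affine unimodular isomorphism. $2\Delta_2=\operatorname{conv}\{(0,0),(2,0),(0,2)\}\subset\mathbb{R}^2$. The free join of lattice polytopes $\Delta_1,\Delta_2$ of dimensions $d_1,d_2$ is $\operatorname{conv}(\Delta_1\times\{0^{d_2}\}\times\{0\},\ \{0^{d_1}\}\times\Delta_2\times\{1\})\subset\mathbb{R}^{d_1+d_2+1}$. -}

module Defs where

open import Level using (Level; _⊔_; 0ℓ) renaming (suc to lsuc)
open import Algebra.Bundles using (CommutativeRing)
import Algebra.Properties.Semiring.Sum as Sum
import Algebra.Properties.Semiring.Mult as Mult
open import Data.Bool.Base using (if_then_else_)
open import Data.Fin.Base using (Fin; splitAt)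
import Data.Fin.Properties as Fin
open import Data.Fin.Permutation using (Permutation′; _⟨$⟩ʳ_)
open import Data.Integer.Base as ℤ using (ℤ; +_; -[1+_]; 0ℤ; 1ℤ; -1ℤ)
open import Data.Integer.Divisibility.Signed using (divides) renaming (_∣_ to _∣ℤ_)
import Data.Integer.Properties as ℤ
open import Data.Integer.Tactic.RingSolver using (solve-∀)
open import Data.Nat.Base as ℕ using (ℕ; suc; NonZero)
open import Data.Nat.DivMod using (_/_)
open import Data.Nat.LCM using (lcm)
open import Data.Product.Base using (Σ-syntax; ∃-syntax; _×_; _,_)
open import Data.Sum.Base using (inj₁; inj₂)
open import Data.Unit.Base using (⊤)
open import Data.Vec.Functional using (Vector; []; _∷_; _++_; replicate)
open import Function.Base using (_∘_)
open import Function.Bundles using (_⇔_)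
open import Relation.Binary.Core using (Rel)
open import Relation.Binary.PropositionalEquality as ≡ using (_≡_; cong; cong₂)
open import Relation.Binary.Structures using (IsTotalOrder)
open import Relation.Nullary using (¬_; does)
open import Relation.Unary using (Pred; _∈_; _∩_; _∪_)

------------------------------------------------------------------------
-- The ring ℤ/N: integers up to congruence

record Congruent (N : ℕ) (x y : ℤ) : Set where
  constructor congruent
  field
    divisible : + N ∣ℤ (x ℤ.- y)

module _ (N : ℕ) where

  private
    reflexive : ∀ {x y} → x ≡ y → Congruent N x y
    reflexive {x} ≡.refl = congruent (divides 0ℤ (ℤ.+-inverseʳ x))

    symm : ∀ {x y} → Congruent N x y → Congruent N y x
    symm {x} {y} (congruent (divides q e)) = congruent (divides (ℤ.- q)
      (≡.trans (swap x y) (≡.trans (cong ℤ.-_ e) (ℤ.neg-distribˡ-* q (+ N)))))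
      where
      swap : ∀ x y → y ℤ.- x ≡ ℤ.- (x ℤ.- y)
      swap = solve-∀

    tran : ∀ {x y z} → Congruent N x y → Congruent N y z → Congruent N x z
    tran {x} {y} {z} (congruent (divides q e)) (congruent (divides r f)) =
      congruent (divides (q ℤ.+ r) (≡.trans (split x y z)
        (≡.trans (cong₂ ℤ._+_ e f) (≡.sym (ℤ.*-distribʳ-+ (+ N) q r)))))
      where
      split : ∀ x y z → x ℤ.- z ≡ (x ℤ.- y) ℤ.+ (y ℤ.- z)
      split = solve-∀

    +-cong : ∀ {x y u v} → Congruent N x y → Congruent N u v →
             Congruent N (x ℤ.+ u) (y ℤ.+ v)
    +-cong {x} {y} {u} {v} (congruent (divides q e)) (congruent (divides r f)) =
      congruent (divides (q ℤ.+ r) (≡.trans (split x y u v)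
        (≡.trans (cong₂ ℤ._+_ e f) (≡.sym (ℤ.*-distribʳ-+ (+ N) q r)))))
      where
      split : ∀ x y u v → (x ℤ.+ u) ℤ.- (y ℤ.+ v) ≡ (x ℤ.- y) ℤ.+ (u ℤ.- v)
      split = solve-∀

    *-cong : ∀ {x y u v} → Congruent N x y → Congruent N u v →
             Congruent N (x ℤ.* u) (y ℤ.* v)
    *-cong {x} {y} {u} {v} (congruent (divides q e)) (congruent (divides r f)) =
      congruent (divides (q ℤ.* u ℤ.+ y ℤ.* r) (≡.trans (split x y u v)
        (≡.trans (cong₂ (λ s t → s ℤ.* u ℤ.+ y ℤ.* t) e f) (collect q r u y (+ N)))))
      where
      split : ∀ x y u v → x ℤ.* u ℤ.- y ℤ.* v ≡ (x ℤ.- y) ℤ.* u ℤ.+ y ℤ.* (u ℤ.- v)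
      split = solve-∀
      collect : ∀ q r u y n → (q ℤ.* n) ℤ.* u ℤ.+ y ℤ.* (r ℤ.* n) ≡ (q ℤ.* u ℤ.+ y ℤ.* r) ℤ.* n
      collect = solve-∀

    neg-cong : ∀ {x y} → Congruent N x y → Congruent N (ℤ.- x) (ℤ.- y)
    neg-cong {x} {y} (congruent (divides q e)) = congruent (divides (ℤ.- q)
      (≡.trans (split x y) (≡.trans (cong ℤ.-_ e) (ℤ.neg-distribˡ-* q (+ N)))))
      where
      split : ∀ x y → ℤ.- x ℤ.- ℤ.- y ≡ ℤ.- (x ℤ.- y)
      split = solve-∀

  ℤ/ : CommutativeRing 0ℓ 0ℓ
  ℤ/ = record
    { Carrier = ℤ
    ; _≈_ = Congruent N
    ; _+_ = ℤ._+_
    ; _*_ = ℤ._*_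
    ; -_ = ℤ.-_
    ; 0# = 0ℤ
    ; 1# = 1ℤ
    ; isCommutativeRing = record
      { isRing = record
        { +-isAbelianGroup = record
          { isGroup = record
            { isMonoid = record
              { isSemigroup = record
                { isMagma = record
                  { isEquivalence = record
                    { refl = reflexive ≡.refl ; sym = symm ; trans = tran }
                  ; ∙-cong = +-cong }
                ; assoc = λ x y z → reflexive (ℤ.+-assoc x y z) }
              ; identity = (λ x → reflexive (ℤ.+-identityˡ x))
                         , (λ x → reflexive (ℤ.+-identityʳ x)) }
            ; inverse = (λ x → reflexive (ℤ.+-inverseˡ x))
                      , (λ x → reflexive (ℤ.+-inverseʳ x))
            ; ⁻¹-cong = neg-cong }
          ; comm = λ x y → reflexive (ℤ.+-comm x y) }
        ; *-cong = *-cong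
        ; *-assoc = λ x y z → reflexive (ℤ.*-assoc x y z)
        ; *-identity = (λ x → reflexive (ℤ.*-identityˡ x))
                     , (λ x → reflexive (ℤ.*-identityʳ x))
        ; distrib = (λ x y z → reflexive (ℤ.*-distribˡ-+ x y z))
                  , (λ x y z → reflexive (ℤ.*-distribʳ-+ x y z)) }
      ; *-comm = λ x y → reflexive (ℤ.*-comm x y) } }

------------------------------------------------------------------------
-- Linear codes

Word : ℕ → ℕ → Set
Word N n = Vector (CommutativeRing.Carrier (ℤ/ N)) n

record Code (N n : ℕ) : Set₁ where
  open CommutativeRing (ℤ/ N)
  field
    words    : Pred (Word N n) 0ℓ
    resp     : ∀ {v w} → (∀ i → v i ≈ w i) → v ∈ words → w ∈ words
    0-closed : (λ _ → 0#) ∈ words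
    +-closed : ∀ {v w} → v ∈ words → w ∈ words → (λ i → v i + w i) ∈ words
    *-closed : ∀ r {v} → v ∈ words → (λ i → r * v i) ∈ words

open Code public using (words)

infix 4 _≋_ _≅_

_≋_ : ∀ {N n} → Code N n → Code N n → Set
C ≋ D = ∀ w → w ∈ words C ⇔ w ∈ words D

_≅_ : ∀ {N n} → Code N n → Code N n → Set
_≅_ {n = n} C D =
  Σ[ σ ∈ Permutation′ n ] ∀ w → w ∈ words C ⇔ (w ∘ (σ ⟨$⟩ʳ_)) ∈ words D

module _ (N : ℕ) {k n : ℕ} where
  open CommutativeRing (ℤ/ N)
  open Sum semiring

  span : Vector (Word N n) k → Code N n
  span g = record
    { words = λ w → ∃[ c ] ∀ j → w j ≈ ∑[ i < k ] (c i * g i j)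
    ; resp = λ v≈w (c , e) → c , λ j → trans (sym (v≈w j)) (e j)
    ; 0-closed = (λ _ → 0#) , λ j →
        sym (trans (sum-cong-≋ (λ i → zeroˡ (g i j))) (sum-replicate-zero k))
    ; +-closed = λ (c , e) (d , f) → (λ i → c i + d i) , λ j →
        trans (+-cong (e j) (f j))
          (trans (sym (∑-distrib-+ (λ i → c i * g i j) (λ i → d i * g i j)))
            (sum-cong-≋ (λ i → sym (distribʳ (g i j) (c i) (d i)))))
    ; *-closed = λ r (c , e) → (λ i → r * c i) , λ j →
        trans (*-congˡ {x = r} (e j))
          (trans (*-distribˡ-sum r (λ i → c i * g i j))
            (sum-cong-≋ (λ i → sym (*-assoc r (c i) (g i j))))) }

module _ {N₁ N₂ n₁ n₂ : ℕ} .{{_ : NonZero N₁}} .{{_ : NonZero N₂}} where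
  private
    L = lcm N₁ N₂
    κ₁ = + (L / N₁)
    κ₂ = + (L / N₂)
  open CommutativeRing (ℤ/ L)

  private
    _∣∣_ : Word N₁ n₁ → Word N₂ n₂ → Word L (n₁ ℕ.+ n₂)
    c₁ ∣∣ c₂ = (λ i → κ₁ * c₁ i) ++ (λ i → κ₂ * c₂ i)

    ∣∣-zero : ∀ j → 0# ≈ ((λ _ → 0#) ∣∣ (λ _ → 0#)) j
    ∣∣-zero j with splitAt n₁ j
    ... | inj₁ _ = sym (zeroʳ κ₁)
    ... | inj₂ _ = sym (zeroʳ κ₂)

    ∣∣-+ : ∀ c₁ c₂ d₁ d₂ j → (c₁ ∣∣ c₂) j + (d₁ ∣∣ d₂) j ≈
           ((λ i → c₁ i + d₁ i) ∣∣ (λ i → c₂ i + d₂ i)) j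
    ∣∣-+ c₁ c₂ d₁ d₂ j with splitAt n₁ j
    ... | inj₁ i = sym (distribˡ κ₁ (c₁ i) (d₁ i))
    ... | inj₂ i = sym (distribˡ κ₂ (c₂ i) (d₂ i))

    exchange : ∀ r s x → r ℤ.* (s ℤ.* x) ≡ s ℤ.* (r ℤ.* x)
    exchange = solve-∀

    ∣∣-* : ∀ r c₁ c₂ j → r * (c₁ ∣∣ c₂) j ≈ ((λ i → r * c₁ i) ∣∣ (λ i → r * c₂ i)) j
    ∣∣-* r c₁ c₂ j with splitAt n₁ j
    ... | inj₁ i = reflexive (exchange r κ₁ (c₁ i))
    ... | inj₂ i = reflexive (exchange r κ₂ (c₂ i))

  infixr 6 _⊕_

  -- Multiplication by L/Nᵢ on representatives is the well-defined map ℤ/Nᵢ → ℤ/L.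
  _⊕_ : Code N₁ n₁ → Code N₂ n₂ → Code L (n₁ ℕ.+ n₂)
  C₁ ⊕ C₂ = record
    { words = λ w → ∃[ c₁ ] ∃[ c₂ ] c₁ ∈ words C₁ × c₂ ∈ words C₂ ×
                (∀ j → w j ≈ ((λ i → κ₁ * c₁ i) ++ (λ i → κ₂ * c₂ i)) j)
    ; resp = λ v≈w (c₁ , c₂ , p₁ , p₂ , e) →
        c₁ , c₂ , p₁ , p₂ , λ j → trans (sym (v≈w j)) (e j)
    ; 0-closed = _ , _ , Code.0-closed C₁ , Code.0-closed C₂ , ∣∣-zero
    ; +-closed = λ (c₁ , c₂ , p₁ , p₂ , e) (d₁ , d₂ , q₁ , q₂ , f) →
        _ , _ , Code.+-closed C₁ p₁ q₁ , Code.+-closed C₂ p₂ q₂ ,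
        λ j → trans (+-cong (e j) (f j)) (∣∣-+ c₁ c₂ d₁ d₂ j)
    ; *-closed = λ r (c₁ , c₂ , p₁ , p₂ , e) →
        _ , _ , Code.*-closed C₁ r p₁ , Code.*-closed C₂ r p₂ ,
        λ j → trans (*-congˡ {x = r} (e j)) (∣∣-* r c₁ c₂ j) }

ZeroSum : ∀ {N n} → Code N n → Set
ZeroSum {N} {n} C = ∀ w → w ∈ words C → sum w ≈ 0#
  where
  open CommutativeRing (ℤ/ N)
  open Sum semiring using (sum)

-- The identity on representatives.
π : ∀ N {n} → Vector ℤ n → Word N n
π N z = z

π⁻¹ : ∀ {N n} → Code N n → Pred (Vector ℤ n) 0ℓ
π⁻¹ {N} C z = π N z ∈ words C

------------------------------------------------------------------------
-- Ordered fields; they stand in for ℝ, which the library does not have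

record OrderedField c ℓ₁ ℓ₂ : Set (lsuc (c ⊔ ℓ₁ ⊔ ℓ₂)) where
  infix 4 _≤_
  field
    commutativeRing : CommutativeRing c ℓ₁
  open CommutativeRing commutativeRing public
  field
    _≤_          : Rel Carrier ℓ₂
    isTotalOrder : IsTotalOrder _≈_ _≤_
    +-monoˡ-≤    : ∀ {x y} z → x ≤ y → x + z ≤ y + z
    *-nonneg     : ∀ {x y} → 0# ≤ x → 0# ≤ y → 0# ≤ x * y
    0≉1          : ¬ (0# ≈ 1#)
    inverse      : ∀ x → ¬ (x ≈ 0#) → ∃[ y ] x * y ≈ 1#

------------------------------------------------------------------------
-- Polytopes and lattices in Kⁿ

module Polytopes {c ℓ₁ ℓ₂} (K : OrderedField c ℓ₁ ℓ₂) where
  open OrderedField K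
  open Sum semiring using (sum-syntax)
  open Mult semiring using () renaming (_×_ to _·_)

  private
    variable
      m n d₁ d₂ k : ℕ
      p l p′ l′ : Level

  Space : ℕ → Set c
  Space = Vector Carrier

  infix 4 _≈ᵥ_

  _≈ᵥ_ : Space n → Space n → Set ℓ₁
  x ≈ᵥ y = ∀ i → x i ≈ y i

  fromℤ : ℤ → Carrier
  fromℤ (+ n)    = n · 1#
  fromℤ -[1+ n ] = - (suc n · 1#)

  fromℤⁿ : Vector ℤ n → Space n
  fromℤⁿ z i = fromℤ (z i)

  combination : Vector Carrier k → Vector (Space n) k → Space n
  combination {k = k} μ v j = ∑[ i < k ] (μ i * v i j)

  Aff : Pred (Space n) p → Pred (Space n) (c ⊔ ℓ₁ ⊔ p)
  Aff {n} S x = ∃[ k ] Σ[ μ ∈ Vector Carrier k ] Σ[ v ∈ Vector (Space n) k ]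
    (∀ i → v i ∈ S) × ∑[ i < k ] μ i ≈ 1# × x ≈ᵥ combination μ v

  Conv : Pred (Space n) p → Pred (Space n) (c ⊔ ℓ₁ ⊔ ℓ₂ ⊔ p)
  Conv {n} S x = ∃[ k ] Σ[ μ ∈ Vector Carrier k ] Σ[ v ∈ Vector (Space n) k ]
    (∀ i → v i ∈ S) × (∀ i → 0# ≤ μ i) × ∑[ i < k ] μ i ≈ 1# × x ≈ᵥ combination μ v

  ⟦_⟧ : Vector (Vector ℤ n) k → Pred (Space n) ℓ₁
  ⟦ v ⟧ x = ∃[ i ] x ≈ᵥ fromℤⁿ (v i)

  Embed : Pred (Vector ℤ n) p → Pred (Space n) (ℓ₁ ⊔ p)
  Embed M x = ∃[ z ] z ∈ M × x ≈ᵥ fromℤⁿ z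

  -- No condition ties the two fields together; it is used for the pairs built below,
  -- where `lattice` is an affine lattice and `polytope` the hull of points of it.
  record LatticeFigure (n : ℕ) (p l : Level) : Set (c ⊔ lsuc (p ⊔ l)) where
    constructor _wrt_
    field
      polytope : Pred (Space n) p
      lattice  : Pred (Space n) l

  open LatticeFigure public

  standard : Pred (Space n) p → LatticeFigure n p ℓ₁
  standard P = P wrt Embed (λ _ → ⊤)

  record AffineMap (n m : ℕ) : Set c where
    field
      linear : Vector (Vector Carrier n) m
      offset : Space m

    apply : Space n → Space m
    apply x i = ∑[ j < n ] (linear i j * x j) + offset i

  open AffineMap public using (apply)

  -- Only the affine hulls of the lattices matter: the maps are mutually inverse
  -- there and arbitrary elsewhere in the ambient spaces.
  record UnimodularIso (P : LatticeFigure n p l) (Q : LatticeFigure m p′ l′)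
    : Set (c ⊔ ℓ₁ ⊔ p ⊔ l ⊔ p′ ⊔ l′) where
    field
      to            : AffineMap n m
      from          : AffineMap m n
      from∘to       : ∀ x → x ∈ Aff (lattice P) → apply from (apply to x) ≈ᵥ x
      to∘from       : ∀ y → y ∈ Aff (lattice Q) → apply to (apply from y) ≈ᵥ y
      to-lattice    : ∀ x → x ∈ lattice P → apply to x ∈ lattice Q
      from-lattice  : ∀ y → y ∈ lattice Q → apply from y ∈ lattice P
      to-polytope   : ∀ x → x ∈ polytope P → apply to x ∈ polytope Q
      from-polytope : ∀ y → y ∈ polytope Q → apply from y ∈ polytope P

  dilatedBasis : ℕ → Vector (Vector ℤ n) n
  dilatedBasis N i j = if does (i Fin.≟ j) then + N else 0ℤ

  simplex : ∀ {N d} (C : Code N (suc d)) → ZeroSum C →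
            LatticeFigure (suc d) (c ⊔ ℓ₁ ⊔ ℓ₂) (c ⊔ ℓ₁)
  simplex {N} C _ = Conv ⟦ dilatedBasis N ⟧ wrt (Aff ⟦ dilatedBasis N ⟧ ∩ Embed (π⁻¹ C))

  freeJoin : Pred (Space d₁) p → Pred (Space d₂) p′ →
             Pred (Space (d₁ ℕ.+ d₂ ℕ.+ 1)) (c ⊔ ℓ₁ ⊔ ℓ₂ ⊔ p ⊔ p′)
  freeJoin {d₁ = d₁} {d₂ = d₂} Δ₁ Δ₂ = Conv
    ( (λ z → ∃[ x ] x ∈ Δ₁ × z ≈ᵥ (x ++ replicate d₂ 0#) ++ (0# ∷ []))
    ∪ (λ z → ∃[ y ] y ∈ Δ₂ × z ≈ᵥ (replicate d₁ 0# ++ y) ++ (1# ∷ [])) )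

  2Δ₂ : Pred (Space 2) (c ⊔ ℓ₁ ⊔ ℓ₂)
  2Δ₂ = Conv ⟦ (0ℤ ∷ 0ℤ ∷ []) ∷ (+ 2 ∷ 0ℤ ∷ []) ∷ (0ℤ ∷ + 2 ∷ []) ∷ [] ⟧

  interval : ℕ → Pred (Space 1) (c ⊔ ℓ₁ ⊔ ℓ₂)
  interval N = Conv ⟦ (0ℤ ∷ []) ∷ (+ N ∷ []) ∷ [] ⟧

------------------------------------------------------------------------
-- Generator matrices

module _ (M₂ : ℕ) where

  g : ℤ → Vector (Vector ℤ 5) 3
  g a = (+ M₂ ∷ + M₂ ∷ 0ℤ   ∷ 0ℤ ∷ 0ℤ     ∷ [])
      ∷ (+ M₂ ∷ 0ℤ   ∷ + M₂ ∷ 1ℤ ∷ -1ℤ    ∷ [])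
      ∷ (0ℤ   ∷ 0ℤ   ∷ 0ℤ   ∷ a  ∷ ℤ.- a  ∷ [])
      ∷ []

  g₀ : Vector (Vector ℤ 5) 3
  g₀ = (+ M₂ ∷ + M₂ ∷ 0ℤ   ∷ 0ℤ ∷ 0ℤ  ∷ [])
     ∷ (+ M₂ ∷ 0ℤ   ∷ + M₂ ∷ 0ℤ ∷ 0ℤ  ∷ [])
     ∷ (0ℤ   ∷ 0ℤ   ∷ 0ℤ   ∷ 1ℤ ∷ -1ℤ ∷ [])
     ∷ []

-- The upper left block of g₀ divided by M₂, to be read over ℤ/2,
-- and its lower right block.
g₁ : Vector (Vector ℤ 3) 2
g₁ = (1ℤ ∷ 1ℤ ∷ 0ℤ ∷ [])
   ∷ (1ℤ ∷ 0ℤ ∷ 1ℤ ∷ [])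
   ∷ []

g₂ : Vector (Vector ℤ 2) 1
g₂ = (1ℤ ∷ -1ℤ ∷ []) ∷ []

{-# OPTIONS --safe #-}
module Submission where

-- Both codes consist of the words (M(p+q), Mp, Mq, r, −r) with M = N/2: for the first one,
-- since a is odd, the coefficients of the last two rows can be chosen with prescribed values
-- of q mod 2 and of r. On the hyperplane ∑ xᵢ = N, the map
--   x ↦ (2x₁/N, 2x₂/N, x₄, (x₃+x₄)/N)
-- carries the integral points congruent to such words onto ℤ⁴ and the simplex onto the free
-- join; its inverse is y ↦ (N − My₀ − My₁ − Ny₃, My₀, My₁, Ny₃ − y₂, y₂). A point of the
-- hyperplane lies in conv(N eᵢ) iff its coordinates are nonnegative, so only the values of
-- five affine functionals on the faces 2Δ₂ and [0,N] have to be checked.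

open import Defs
open import Algebra.Bundles using (CommutativeRing)
import Algebra.Properties.Ring as RingProperties
import Algebra.Properties.Semiring.Mult as Mult
import Algebra.Properties.Semiring.Sum as Sum
import Algebra.Solver.Ring as RingSolver
open import Algebra.Solver.Ring.AlmostCommutativeRing using (fromCommutativeRing; _-Raw-AlmostCommutative⟶_; Induced-equivalence)
open import Data.Fin.Base using (zero; suc)
open import Data.Fin.Patterns using (0F; 1F; 2F; 3F; 4F)
import Data.Fin.Permutation as Permutation
open import Data.Integer.Base as ℤ using (ℤ; +_; -[1+_]; 0ℤ; 1ℤ; -1ℤ)
open import Data.Integer.Divisibility.Signed using (divides) renaming (_∣_ to _∣ℤ_)
open import Data.Integer.DivMod using (_/ℕ_; _%ℕ_; a≡a%ℕn+[a/ℕn]*n; n%ℕd<d)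
import Data.Integer.Properties as ℤ
open import Data.Integer.Tactic.RingSolver using (solve-∀)
open import Data.Maybe.Base using (just; nothing)
open import Data.Nat.Base as ℕ using (ℕ; zero; suc; s≤s; NonZero)
open import Data.Nat.Divisibility using (_∣_; ∣-antisym; ∣-refl)
open import Data.Nat.DivMod using (_/_; n/n≡1; m*n/n≡m; m/n*n≡m; /-congˡ)
open import Data.Nat.LCM using (lcm; lcm-least; n∣lcm[m,n])
import Data.Nat.Properties as ℕ
open import Data.Product.Base using (_×_; _,_; Σ-syntax; ∃-syntax; proj₁; proj₂)
open import Data.Sum.Base using (inj₁; inj₂)
open import Data.Vec.Functional using (Vector; []; _∷_; _++_; replicate)
open import Function.Bundles using (_⇔_; mk⇔; Equivalence)
open import Function.Construct.Composition using (_⇔-∘_)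
open import Function.Construct.Symmetry using (⇔-sym)
open import Level using (_⊔_)
open import Relation.Binary.Definitions using (WeaklyDecidable)
open import Relation.Binary.PropositionalEquality as ≡ using (_≡_; cong; subst)
import Relation.Binary.Reasoning.Setoid as SetoidReasoning
open import Relation.Binary.Structures using (IsTotalOrder)
open import Relation.Nullary using (¬_; contradiction; yes; no)
open import Relation.Unary using (Pred; _∈_; _∪_)

-- Equal moduli and parity

recast : ∀ {L N x y} → L ≡ N → Congruent L x y → Congruent N x y
recast ≡.refl x≈y = x≈y

-- As in `recast`, both moduli are variables, so that the equation can be matched with `refl`; the
-- instance `lcm 2 N ≡ N` could not be matched directly.
subst-words : ∀ {L N n} (eq : L ≡ N) (D : Code L n) w →
              w ∈ words (subst (λ L → Code L n) eq D) ⇔ w ∈ words D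
subst-words ≡.refl D w = mk⇔ (λ p → p) (λ p → p)

odd⇒2b+1 : ∀ a → ¬ (+ 2 ∣ℤ a) → ∃[ b ] a ≡ b ℤ.* + 2 ℤ.+ 1ℤ
odd⇒2b+1 a odd with a %ℕ 2 | a≡a%ℕn+[a/ℕn]*n a 2 | n%ℕd<d a 2
... | 0 | e | _ = contradiction (divides (a /ℕ 2) (≡.trans e (ℤ.+-identityˡ _))) odd
... | 1 | e | _ = a /ℕ 2 , ≡.trans e (ℤ.+-comm 1ℤ (a /ℕ 2 ℤ.* + 2))
... | suc (suc _) | _ | s≤s (s≤s ())

-- The common normal form of the codewords

module Codes (N M : ℕ) (N≡M*2 : N ≡ M ℕ.* 2) where
  open CommutativeRing (ℤ/ N) using (_≈_; trans; sym; reflexive; -‿cong; semiring)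
  open CommutativeRing (ℤ/ 2) using () renaming (_≈_ to _≈₂_; refl to refl₂; reflexive to reflexive₂; trans to trans₂; +-cong to +-cong₂; semiring to semiring₂)
  open Sum semiring
  open Sum semiring₂ using () renaming (sum to sum₂)

  N≡ : + N ≡ + M ℤ.* + 2
  N≡ = ≡.trans (cong +_ N≡M*2) (ℤ.pos-* M 2)

  -- The modulus is written as M·2 because the ring solver sees N and M as unrelated atoms.
  by-multiple : ∀ {x y} q → x ℤ.- y ≡ q ℤ.* (+ M ℤ.* + 2) → x ≈ y
  by-multiple q e = congruent (divides q (≡.trans e (cong (q ℤ.*_) (≡.sym N≡))))

  -- From x - y = 2q follows Mx - My = qN. Thus multiplication by M is a well-defined map from ℤ/2
  -- to ℤ/N, and p and q matter in `word p q r` only modulo 2.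
  M*-cong : ∀ {x y} → x ≈₂ y → + M ℤ.* x ≈ + M ℤ.* y
  M*-cong {x} {y} (congruent (divides q e)) = by-multiple q
    (≡.trans (factor (+ M) x y) (≡.trans (cong (+ M ℤ.*_) e) (exchange (+ M) q)))
    where
    factor : ∀ m x y → m ℤ.* x ℤ.- m ℤ.* y ≡ m ℤ.* (x ℤ.- y)
    factor = solve-∀
    exchange : ∀ m q → m ℤ.* (q ℤ.* + 2) ≡ q ℤ.* (m ℤ.* + 2)
    exchange = solve-∀

  word : ℤ → ℤ → ℤ → Vector ℤ 5
  word p q r = + M ℤ.* (p ℤ.+ q) ∷ + M ℤ.* p ∷ + M ℤ.* q ∷ r ∷ ℤ.- r ∷ []

  word-cong : ∀ {p q r p′ q′ r′} → p ≈₂ p′ → q ≈₂ q′ → r ≈ r′ →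
              ∀ j → word p q r j ≈ word p′ q′ r′ j
  word-cong p≈ q≈ r≈ 0F = M*-cong (+-cong₂ p≈ q≈)
  word-cong p≈ q≈ r≈ 1F = M*-cong p≈
  word-cong p≈ q≈ r≈ 2F = M*-cong q≈
  word-cong p≈ q≈ r≈ 3F = r≈
  word-cong p≈ q≈ r≈ 4F = -‿cong r≈

  -- The equality holds already in ℤ. The sum over `Fin 3` computes to a right-nested sum ending in
  -- 0, the shape given to the solver in each coordinate.
  ∑g≡word : ∀ a (c : Vector ℤ 3) j →
            ∑[ i < 3 ] (c i ℤ.* g M a i j) ≡ word (c 0F) (c 1F) (c 1F ℤ.+ c 2F ℤ.* a) j
  ∑g≡word a c = λ
    { 0F → e₀ (c 0F) (c 1F) (c 2F) (+ M) ; 1F → e₁ (c 0F) (c 1F) (c 2F) (+ M)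
    ; 2F → e₂ (c 0F) (c 1F) (c 2F) (+ M) ; 3F → e₃ (c 0F) (c 1F) (c 2F) a
    ; 4F → e₄ (c 0F) (c 1F) (c 2F) a }
    where
    e₀ : ∀ p q r m → p ℤ.* m ℤ.+ (q ℤ.* m ℤ.+ (r ℤ.* 0ℤ ℤ.+ 0ℤ)) ≡ m ℤ.* (p ℤ.+ q)
    e₀ = solve-∀
    e₁ : ∀ p q r m → p ℤ.* m ℤ.+ (q ℤ.* 0ℤ ℤ.+ (r ℤ.* 0ℤ ℤ.+ 0ℤ)) ≡ m ℤ.* p
    e₁ = solve-∀
    e₂ : ∀ p q r m → p ℤ.* 0ℤ ℤ.+ (q ℤ.* m ℤ.+ (r ℤ.* 0ℤ ℤ.+ 0ℤ)) ≡ m ℤ.* q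
    e₂ = solve-∀
    e₃ : ∀ p q r a → p ℤ.* 0ℤ ℤ.+ (q ℤ.* 1ℤ ℤ.+ (r ℤ.* a ℤ.+ 0ℤ)) ≡ q ℤ.+ r ℤ.* a
    e₃ = solve-∀
    e₄ : ∀ p q r a → p ℤ.* 0ℤ ℤ.+ (q ℤ.* -1ℤ ℤ.+ (r ℤ.* (ℤ.- a) ℤ.+ 0ℤ)) ≡ ℤ.- (q ℤ.+ r ℤ.* a)
    e₄ = solve-∀

  ∑g₀≡word : ∀ (c : Vector ℤ 3) j →
             ∑[ i < 3 ] (c i ℤ.* g₀ M i j) ≡ word (c 0F) (c 1F) (c 2F) j
  ∑g₀≡word c = λ
    { 0F → e₀ (c 0F) (c 1F) (c 2F) (+ M) ; 1F → e₁ (c 0F) (c 1F) (c 2F) (+ M)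
    ; 2F → e₂ (c 0F) (c 1F) (c 2F) (+ M) ; 3F → e₃ (c 0F) (c 1F) (c 2F)
    ; 4F → e₄ (c 0F) (c 1F) (c 2F) }
    where
    e₀ : ∀ p q r m → p ℤ.* m ℤ.+ (q ℤ.* m ℤ.+ (r ℤ.* 0ℤ ℤ.+ 0ℤ)) ≡ m ℤ.* (p ℤ.+ q)
    e₀ = solve-∀
    e₁ : ∀ p q r m → p ℤ.* m ℤ.+ (q ℤ.* 0ℤ ℤ.+ (r ℤ.* 0ℤ ℤ.+ 0ℤ)) ≡ m ℤ.* p
    e₁ = solve-∀
    e₂ : ∀ p q r m → p ℤ.* 0ℤ ℤ.+ (q ℤ.* m ℤ.+ (r ℤ.* 0ℤ ℤ.+ 0ℤ)) ≡ m ℤ.* q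
    e₂ = solve-∀
    e₃ : ∀ p q r → p ℤ.* 0ℤ ℤ.+ (q ℤ.* 0ℤ ℤ.+ (r ℤ.* 1ℤ ℤ.+ 0ℤ)) ≡ r
    e₃ = solve-∀
    e₄ : ∀ p q r → p ℤ.* 0ℤ ℤ.+ (q ℤ.* 0ℤ ℤ.+ (r ℤ.* -1ℤ ℤ.+ 0ℤ)) ≡ ℤ.- r
    e₄ = solve-∀

  -- The description through which all codes are compared: each of them is shown to consist of
  -- exactly these words.
  IsWord : Vector ℤ 5 → Set
  IsWord w = ∃[ p ] ∃[ q ] ∃[ r ] ∀ j → w j ≈ word p q r j

  g₀⇔word : ∀ w → w ∈ words (span N (g₀ M)) ⇔ IsWord w
  g₀⇔word w = mk⇔
    (λ (c , w≈) → c 0F , c 1F , c 2F , λ j → trans (w≈ j) (reflexive (∑g₀≡word c j)))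
    (λ (p , q , r , w≈) → let c = p ∷ q ∷ r ∷ [] in
      c , λ j → trans (w≈ j) (reflexive (≡.sym (∑g₀≡word c j))))

  -- With a = 2b + 1 and s = r − q, the second coefficient q − 2bs agrees with q mod 2,
  -- while (q − 2bs) + sa = r.
  g⇔word : ∀ a → ¬ (+ 2 ∣ℤ a) → ∀ w → w ∈ words (span N (g M a)) ⇔ IsWord w
  g⇔word a odd w = mk⇔
    (λ (c , w≈) → c 0F , c 1F , c 1F ℤ.+ c 2F ℤ.* a , λ j →
      trans (w≈ j) (reflexive (∑g≡word a c j)))
    (λ (p , q , r , w≈) →
      let b , a≡ = odd⇒2b+1 a odd
          s = r ℤ.- q
          c = p ∷ q ℤ.- b ℤ.* s ℤ.* + 2 ∷ s ∷ []
      in c , λ j → trans (w≈ j) (trans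
           (word-cong (refl₂)
             (congruent (divides (b ℤ.* s) (difference q (b ℤ.* s))))
             (reflexive (≡.sym (≡.trans
               (cong (λ a → q ℤ.- b ℤ.* s ℤ.* + 2 ℤ.+ s ℤ.* a) a≡) (last q r b)))) j)
           (reflexive (≡.sym (∑g≡word a c j)))))
    where
    difference : ∀ q t → q ℤ.- (q ℤ.- t ℤ.* + 2) ≡ t ℤ.* + 2
    difference = solve-∀
    last : ∀ q r b → q ℤ.- b ℤ.* (r ℤ.- q) ℤ.* + 2 ℤ.+ (r ℤ.- q) ℤ.* (b ℤ.* + 2 ℤ.+ 1ℤ) ≡ r
    last = solve-∀

  -- The entries r and -r cancel, and M(p+q) + Mp + Mq = (p+q)·2M is a multiple of N.
  sum-word≈0 : ∀ w → IsWord w → sum w ≈ 0ℤ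
  sum-word≈0 w (p , q , r , w≈) = trans (sum-cong-≋ w≈)
    (by-multiple (p ℤ.+ q) (total p q r (+ M)))
    where
    total : ∀ p q r m →
      m ℤ.* (p ℤ.+ q) ℤ.+ (m ℤ.* p ℤ.+ (m ℤ.* q ℤ.+ (r ℤ.+ (ℤ.- r ℤ.+ 0ℤ)))) ℤ.- 0ℤ
        ≡ (p ℤ.+ q) ℤ.* (m ℤ.* + 2)
    total = solve-∀

  g₁-word : ∀ (c : Vector ℤ 2) j →
    sum₂ {2} (λ i → c i ℤ.* g₁ i j) ≈₂ (c 0F ℤ.+ c 1F ∷ c 0F ∷ c 1F ∷ []) j
  g₁-word c = λ
    { 0F → reflexive₂ (e₀ (c 0F) (c 1F))
    ; 1F → reflexive₂ (e₁ (c 0F) (c 1F))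
    ; 2F → reflexive₂ (e₂ (c 0F) (c 1F)) }
    where
    e₀ : ∀ p q → p ℤ.* 1ℤ ℤ.+ (q ℤ.* 1ℤ ℤ.+ 0ℤ) ≡ p ℤ.+ q
    e₀ = solve-∀
    e₁ : ∀ p q → p ℤ.* 1ℤ ℤ.+ (q ℤ.* 0ℤ ℤ.+ 0ℤ) ≡ p
    e₁ = solve-∀
    e₂ : ∀ p q → p ℤ.* 0ℤ ℤ.+ (q ℤ.* 1ℤ ℤ.+ 0ℤ) ≡ q
    e₂ = solve-∀

  g₂-word : ∀ (c : Vector ℤ 1) j →
    ∑[ i < 1 ] (c i ℤ.* g₂ i j) ≡ (c 0F ∷ ℤ.- c 0F ∷ []) j
  g₂-word c = λ { 0F → e₀ (c 0F) ; 1F → e₁ (c 0F) }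
    where
    e₀ : ∀ r → r ℤ.* 1ℤ ℤ.+ 0ℤ ≡ r
    e₀ = solve-∀
    e₁ : ∀ r → r ℤ.* -1ℤ ℤ.+ 0ℤ ≡ ℤ.- r
    e₁ = solve-∀

  module _ .{{_ : NonZero N}} (lcm≡N : lcm 2 N ≡ N) where

    κ₁≡M : + (lcm 2 N / 2) ≡ + M
    κ₁≡M = cong +_ (≡.trans (/-congˡ (≡.trans lcm≡N N≡M*2)) (m*n/n≡m M 2))

    κ₂*x≡x : ∀ x → + (lcm 2 N / N) ℤ.* x ≡ x
    κ₂*x≡x x = ≡.trans (cong (λ k → + k ℤ.* x) (≡.trans (/-congˡ lcm≡N) (n/n≡1 N))) (ℤ.*-identityˡ x)

    κ₁*-cong : ∀ {x y} → x ≈₂ y → + (lcm 2 N / 2) ℤ.* x ≈ + M ℤ.* y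
    κ₁*-cong {x} x≈y = trans (reflexive (cong (ℤ._* x) κ₁≡M)) (M*-cong x≈y)

    -- Since the lcm is N, the two scaling factors are N/2 = M and N/N = 1. With c₁ ≡ (p+q, p, q)
    -- modulo 2 and c₂ ≡ (r, -r) modulo N, the concatenation (M c₁, c₂) is `word p q r`.
    ⊕⇔word : ∀ w → w ∈ words (span 2 g₁ ⊕ span N g₂) ⇔ IsWord w
    ⊕⇔word w = mk⇔
      (λ (c₁ , c₂ , (d , c₁≈) , (e , c₂≈) , w≈) → d 0F , d 1F , e 0F , λ j →
        trans (recast lcm≡N (w≈ j)) (concat≈word d e c₁≈ c₂≈ j))
      (λ (p , q , r , w≈) →
        let d = p ∷ q ∷ []
            e = r ∷ []
        in _ , _ , (d , λ _ → refl₂) , (e , λ _ → reflexive ≡.refl) , λ j →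
           recast (≡.sym lcm≡N) (trans (w≈ j)
             (sym (concat≈word d e (λ _ → refl₂) (λ _ → reflexive ≡.refl) j))))
      where
      concat≈word : ∀ (d : Vector ℤ 2) (e : Vector ℤ 1) {c₁ : Vector ℤ 3} {c₂ : Vector ℤ 2} →
        (∀ j → c₁ j ≈₂ sum₂ {2} (λ i → d i ℤ.* g₁ i j)) →
        (∀ j → c₂ j ≈ ∑[ i < 1 ] (e i ℤ.* g₂ i j)) →
        ∀ j → ((λ i → + (lcm 2 N / 2) ℤ.* c₁ i) ++ (λ i → + (lcm 2 N / N) ℤ.* c₂ i)) j
              ≈ word (d 0F) (d 1F) (e 0F) j
      concat≈word d e {c₁} {c₂} c₁≈ c₂≈ = λ
        { 0F → first 0F ; 1F → first 1F ; 2F → first 2F ; 3F → second 0F ; 4F → second 1F }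
        where
        first = λ i → κ₁*-cong (trans₂ (c₁≈ i) (g₁-word d i))
        second = λ i → trans (reflexive (κ₂*x≡x (c₂ i)))
                         (trans (c₂≈ i) (reflexive (g₂-word e i)))

  -- Congruences become exact divisibilities in ℤ: w₁ = Mp + k₁N = M(p + 2k₁), likewise for w₂, and
  -- r cancels in w₃ + w₄. These are the multiples that the map onto ℤ⁴ divides out.
  word-multiples : ∀ w → IsWord w →
    ∃[ p ] ∃[ q ] ∃[ t ] (w 1F ≡ + M ℤ.* p × w 2F ≡ + M ℤ.* q × w 3F ℤ.+ w 4F ≡ + N ℤ.* t)
  word-multiples w (p , q , r , w≈) with w≈ 1F | w≈ 2F | w≈ 3F | w≈ 4F
  ... | congruent (divides k₁ e₁) | congruent (divides k₂ e₂)
      | congruent (divides k₃ e₃) | congruent (divides k₄ e₄) =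
    p ℤ.+ k₁ ℤ.* + 2 , q ℤ.+ k₂ ℤ.* + 2 , k₃ ℤ.+ k₄ , half p k₁ e₁ , half q k₂ e₂ ,
    ≡.trans (≡.trans (regroup (w 3F) (w 4F) r) (≡.cong₂ ℤ._+_ e₃ e₄)) (collect k₃ k₄ (+ N))
    where
    restore : ∀ x y → x ≡ (x ℤ.- y) ℤ.+ y
    restore = solve-∀
    expand : ∀ m p k → k ℤ.* (m ℤ.* + 2) ℤ.+ m ℤ.* p ≡ m ℤ.* (p ℤ.+ k ℤ.* + 2)
    expand = solve-∀
    half : ∀ {x} p k → x ℤ.- + M ℤ.* p ≡ k ℤ.* + N → x ≡ + M ℤ.* (p ℤ.+ k ℤ.* + 2)
    half {x} p k e = ≡.trans (restore x (+ M ℤ.* p)) (≡.trans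
      (cong (ℤ._+ + M ℤ.* p) (≡.trans e (cong (k ℤ.*_) N≡))) (expand (+ M) p k))
    regroup : ∀ x y r → x ℤ.+ y ≡ (x ℤ.- r) ℤ.+ (y ℤ.- ℤ.- r)
    regroup = solve-∀
    collect : ∀ k l n → k ℤ.* n ℤ.+ l ℤ.* n ≡ n ℤ.* (k ℤ.+ l)
    collect = solve-∀

  -- The inverse map on integral points; `fromFormula` is its counterpart over the field.
  fromWord : Vector ℤ 4 → Vector ℤ 5
  fromWord z = + N ℤ.- + M ℤ.* z 0F ℤ.- + M ℤ.* z 1F ℤ.- + N ℤ.* z 3F
    ∷ + M ℤ.* z 0F ∷ + M ℤ.* z 1F ∷ + N ℤ.* z 3F ℤ.- z 2F ∷ z 2F ∷ []

  -- The parameter r is read off from the fourth entry; the last entry z₂ differs from -r by N z₃.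
  -- In the first entry, -M(z₀+z₁) and M(z₀+z₁) agree modulo N = 2M.
  fromWord-isWord : ∀ z → IsWord (fromWord z)
  fromWord-isWord z = z 0F , z 1F , + N ℤ.* z 3F ℤ.- z 2F , λ
    { 0F → by-multiple (1ℤ ℤ.- z 3F ℤ.- (z 0F ℤ.+ z 1F)) (≡.trans
        (cong (λ k → k ℤ.- + M ℤ.* z 0F ℤ.- + M ℤ.* z 1F ℤ.- k ℤ.* z 3F ℤ.- + M ℤ.* (z 0F ℤ.+ z 1F)) N≡)
        (e₀ (+ M) (z 0F) (z 1F) (z 3F)))
    ; 1F → reflexive ≡.refl
    ; 2F → reflexive ≡.refl
    ; 3F → reflexive ≡.refl
    ; 4F → congruent (divides (z 3F) (e₄ (+ N) (z 2F) (z 3F))) }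
    where
    e₀ : ∀ m x y t → m ℤ.* + 2 ℤ.- m ℤ.* x ℤ.- m ℤ.* y ℤ.- m ℤ.* + 2 ℤ.* t ℤ.- m ℤ.* (x ℤ.+ y)
                   ≡ (1ℤ ℤ.- t ℤ.- (x ℤ.+ y)) ℤ.* (m ℤ.* + 2)
    e₀ = solve-∀
    e₄ : ∀ n y t → y ℤ.- ℤ.- (n ℤ.* t ℤ.- y) ≡ t ℤ.* n
    e₄ = solve-∀

-- The integers inside an ordered field

module Field {c ℓ₁ ℓ₂} (K : OrderedField c ℓ₁ ℓ₂) where
  open OrderedField K hiding (zero)
  open Polytopes K
  open IsTotalOrder isTotalOrder using (total; antisym) renaming
    (trans to ≤-trans; reflexive to ≤-reflexive; ≤-respˡ-≈ to respˡ; ≤-respʳ-≈ to respʳ)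
  open Mult semiring using (×-homo-+; ×1-homo-*) renaming (_×_ to _·_)
  open Sum semiring
  open RingProperties ring using (-‿+-comm; -‿distribˡ-*; -‿distribʳ-*; -‿involutive; -0#≈0#)
  open SetoidReasoning setoid

  fromℤ-1 : fromℤ 1ℤ ≈ 1#
  fromℤ-1 = +-identityʳ 1#

  fromℤ-neg : ∀ x → fromℤ (ℤ.- x) ≈ - fromℤ x
  fromℤ-neg (+ zero)  = sym -0#≈0#
  fromℤ-neg (+ suc n) = refl
  fromℤ-neg -[1+ n ]  = sym (-‿involutive _)

  fromℤ-⊖ : ∀ m n → fromℤ (m ℤ.⊖ n) ≈ m · 1# - n · 1#
  fromℤ-⊖ m zero = sym (trans (+-congˡ -0#≈0#) (+-identityʳ _))
  fromℤ-⊖ zero (suc n) = sym (+-identityˡ _)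
  fromℤ-⊖ (suc m) (suc n) = begin
    fromℤ (suc m ℤ.⊖ suc n)                ≡⟨ ≡.cong fromℤ (ℤ.[1+m]⊖[1+n]≡m⊖n m n) ⟩
    fromℤ (m ℤ.⊖ n)                        ≈⟨ fromℤ-⊖ m n ⟩
    m · 1# - n · 1#                        ≈⟨ +-congˡ (+-identityˡ _) ⟨
    -- Inserting 0 = 1 - 1 supplies the missing summand on both sides.
    m · 1# + (0# - n · 1#)                 ≈⟨ +-congˡ (+-congʳ (-‿inverseʳ 1#)) ⟨
    m · 1# + ((1# - 1#) - n · 1#)          ≈⟨ +-congˡ (+-assoc 1# (- 1#) _) ⟩
    m · 1# + (1# + (- 1# - n · 1#))        ≈⟨ +-assoc _ 1# _ ⟨
    m · 1# + 1# + (- 1# - n · 1#)          ≈⟨ +-cong (+-comm _ 1#) (-‿+-comm 1# _) ⟩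
    1# + m · 1# - (1# + n · 1#)            ∎

  fromℤ-+ : ∀ x y → fromℤ (x ℤ.+ y) ≈ fromℤ x + fromℤ y
  fromℤ-+ (+ m)    (+ n)    = ×-homo-+ 1# m n
  fromℤ-+ (+ m)    -[1+ n ] = fromℤ-⊖ m (suc n)
  fromℤ-+ -[1+ m ] (+ n)    = trans (fromℤ-⊖ n (suc m)) (+-comm _ _)
  fromℤ-+ -[1+ m ] -[1+ n ] = begin
    - (suc (suc (m ℕ.+ n)) · 1#)        ≡⟨ ≡.cong (λ k → - (k · 1#)) (≡.cong suc (ℕ.+-suc m n)) ⟨
    - ((suc m ℕ.+ suc n) · 1#)          ≈⟨ -‿cong (×-homo-+ 1# (suc m) (suc n)) ⟩
    - (suc m · 1# + suc n · 1#)         ≈⟨ -‿+-comm _ _ ⟨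
    - (suc m · 1#) - suc n · 1#         ∎


  -- The case of a nonnegative left factor, to which `fromℤ-*` reduces the negative one by pulling
  -- out the sign.
  fromℤ-+* : ∀ m y → fromℤ (+ m ℤ.* y) ≈ m · 1# * fromℤ y
  fromℤ-+* m (+ n) = begin
    fromℤ (+ m ℤ.* + n)   ≡⟨ ≡.cong fromℤ (ℤ.pos-* m n) ⟨
    (m ℕ.* n) · 1#        ≈⟨ ×1-homo-* m n ⟩
    m · 1# * (n · 1#)     ∎
  fromℤ-+* m -[1+ n ] = begin
    fromℤ (+ m ℤ.* -[1+ n ])         ≡⟨ ≡.cong fromℤ (ℤ.neg-distribʳ-* (+ m) (+ suc n)) ⟨
    fromℤ (ℤ.- (+ m ℤ.* + suc n))    ≈⟨ fromℤ-neg (+ m ℤ.* + suc n) ⟩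
    - fromℤ (+ m ℤ.* + suc n)        ≈⟨ -‿cong (fromℤ-+* m (+ suc n)) ⟩
    - (m · 1# * (suc n · 1#))        ≈⟨ -‿distribʳ-* _ _ ⟩
    m · 1# * - (suc n · 1#)          ∎

  fromℤ-* : ∀ x y → fromℤ (x ℤ.* y) ≈ fromℤ x * fromℤ y
  fromℤ-* (+ m)    y = fromℤ-+* m y
  fromℤ-* -[1+ m ] y = begin
    fromℤ (-[1+ m ] ℤ.* y)           ≡⟨ ≡.cong fromℤ (ℤ.neg-distribˡ-* (+ suc m) y) ⟨
    fromℤ (ℤ.- (+ suc m ℤ.* y))      ≈⟨ fromℤ-neg (+ suc m ℤ.* y) ⟩
    - fromℤ (+ suc m ℤ.* y)          ≈⟨ -‿cong (fromℤ-+* (suc m) y) ⟩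
    - (suc m · 1# * fromℤ y)         ≈⟨ -‿distribˡ-* _ _ ⟩
    - (suc m · 1#) * fromℤ y         ∎

  -- Integers serve as solver coefficients, since their equality is decidable. The constant `con 1ℤ`
  -- denotes `fromℤ 1ℤ`, which computes to 1 + 0 and not to `1#`; hence the entries `fromℤ 1ℤ` in
  -- the slopes and matrices below.
  fromℤ-morphism : ℤ.+-*-rawRing -Raw-AlmostCommutative⟶ fromCommutativeRing commutativeRing
  fromℤ-morphism = record
    { ⟦_⟧ = fromℤ ; +-homo = fromℤ-+ ; *-homo = fromℤ-* ; -‿homo = fromℤ-neg
    ; 0-homo = refl ; 1-homo = fromℤ-1 }

  fromℤ-≟ : WeaklyDecidable (Induced-equivalence fromℤ-morphism)
  fromℤ-≟ x y with x ℤ.≟ y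
  ... | yes x≡y = just (reflexive (≡.cong fromℤ x≡y))
  ... | no  _   = nothing

  open RingSolver ℤ.+-*-rawRing (fromCommutativeRing commutativeRing) fromℤ-morphism fromℤ-≟ public
    using (solve; con; _:=_; _:+_; _:*_; _:-_; :-_)

  -- Signs in an ordered field

  x≤0⇒0≤-x : ∀ {x} → x ≤ 0# → 0# ≤ - x
  x≤0⇒0≤-x {x} x≤0 = respˡ (-‿inverseʳ x) (respʳ (+-identityˡ (- x)) (+-monoˡ-≤ (- x) x≤0))

  0≤x*x : ∀ x → 0# ≤ x * x
  0≤x*x x with total 0# x
  ... | inj₁ 0≤x = *-nonneg 0≤x 0≤x
  ... | inj₂ x≤0 = respʳ (solve 1 (λ x → (:- x) :* (:- x) := x :* x) refl x)
                     (*-nonneg (x≤0⇒0≤-x x≤0) (x≤0⇒0≤-x x≤0))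

  0≤1 : 0# ≤ 1#
  0≤1 = respʳ (*-identityˡ 1#) (0≤x*x 1#)

  +-nonneg : ∀ {x y} → 0# ≤ x → 0# ≤ y → 0# ≤ x + y
  +-nonneg {x} {y} 0≤x 0≤y = ≤-trans 0≤y (respˡ (+-identityˡ y) (+-monoˡ-≤ y 0≤x))

  ∑-nonneg : ∀ {k} (x : Vector Carrier k) → (∀ i → 0# ≤ x i) → 0# ≤ ∑[ i < k ] x i
  ∑-nonneg {zero}  x 0≤x = ≤-reflexive refl
  ∑-nonneg {suc k} x 0≤x = +-nonneg (0≤x zero) (∑-nonneg (λ i → x (suc i)) (λ i → 0≤x (suc i)))

  fromℕ-nonneg : ∀ n → 0# ≤ fromℤ (+ n)
  fromℕ-nonneg zero    = ≤-reflexive refl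
  fromℕ-nonneg (suc n) = +-nonneg 0≤1 (fromℕ-nonneg n)

  -- If 1 + n = 0, then 0 ≤ 1 ≤ 1 + n = 0 forces 0 = 1.
  fromℕ≉0 : ∀ n .{{_ : NonZero n}} → ¬ (fromℤ (+ n) ≈ 0#)
  fromℕ≉0 (suc n) 1+n≈0 = 0≉1 (antisym 0≤1 (respʳ 1+n≈0
    (respˡ (+-identityˡ 1#) (respʳ (+-comm _ 1#) (+-monoˡ-≤ 1# (fromℕ-nonneg n))))))

  -- Writing u = (xu)u = x·u² shows the sign without a case distinction on u.
  inverse-nonneg : ∀ {x u} → 0# ≤ x → x * u ≈ 1# → 0# ≤ u
  inverse-nonneg {x} {u} 0≤x xu≈1 = respʳ xuu≈u (*-nonneg 0≤x (0≤x*x u))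
    where
    xuu≈u : x * (u * u) ≈ u
    xuu≈u = trans (sym (*-assoc x u u)) (trans (*-congʳ xu≈1) (*-identityˡ u))

  -- Affine functionals on convex and affine hulls

  affine-combination : ∀ {n k} (l : Vector Carrier n) b (μ : Vector Carrier k) v → ∑[ i < k ] μ i ≈ 1# →
    ∑[ j < n ] (l j * combination μ v j) + b ≈ ∑[ i < k ] (μ i * (∑[ j < n ] (l j * v i j) + b))
  affine-combination {n} {k} l b μ v ∑μ≈1 = begin
    ∑[ j < n ] (l j * ∑[ i < k ] (μ i * v i j)) + b
      -- The constant is rewritten as b = (∑ μᵢ) b, so that it can be distributed over the points.
      ≈⟨ +-cong (sum-cong-≋ (λ j → *-distribˡ-sum (l j) (λ i → μ i * v i j)))
                (sym (trans (*-congʳ ∑μ≈1) (*-identityˡ b))) ⟩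
    ∑[ j < n ] ∑[ i < k ] (l j * (μ i * v i j)) + (∑[ i < k ] μ i) * b
      ≈⟨ +-cong (∑-comm (λ j i → l j * (μ i * v i j))) (*-distribʳ-sum b μ) ⟩
    ∑[ i < k ] ∑[ j < n ] (l j * (μ i * v i j)) + ∑[ i < k ] (μ i * b)
      ≈⟨ +-congʳ (sum-cong-≋ λ i → sum-cong-≋ λ j →
           solve 3 (λ l μ v → l :* (μ :* v) := μ :* (l :* v)) refl (l j) (μ i) (v i j)) ⟩
    ∑[ i < k ] ∑[ j < n ] (μ i * (l j * v i j)) + ∑[ i < k ] (μ i * b)
      ≈⟨ ∑-distrib-+ (λ i → ∑[ j < n ] (μ i * (l j * v i j))) (λ i → μ i * b) ⟨
    ∑[ i < k ] (∑[ j < n ] (μ i * (l j * v i j)) + μ i * b)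
      ≈⟨ sum-cong-≋ (λ i → trans (distribˡ (μ i) _ b) (+-congʳ (*-distribˡ-sum (μ i) (λ j → l j * v i j)))) ⟨
    ∑[ i < k ] (μ i * (∑[ j < n ] (l j * v i j) + b)) ∎

  -- A predicate on arbitrary functions, so that plain formulas such as `total-of` and coordinates
  -- of an `AffineMap` are handled alike.
  record IsAffine {n} (φ : Space n → Carrier) : Set (c ⊔ ℓ₁) where
    field
      slope     : Vector Carrier n
      intercept : Carrier
      expansion : ∀ x → φ x ≈ ∑[ j < n ] (slope j * x j) + intercept

    respects : ∀ {x y} → x ≈ᵥ y → φ x ≈ φ y
    respects {x} {y} x≈y = trans (expansion x)
      (trans (+-congʳ (sum-cong-≋ (λ j → *-congˡ (x≈y j)))) (sym (expansion y)))

    on-combination : ∀ {k} (μ : Vector Carrier k) v → ∑[ i < k ] μ i ≈ 1# →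
                     φ (combination μ v) ≈ ∑[ i < k ] (μ i * φ (v i))
    on-combination μ v ∑μ≈1 = trans (expansion _) (trans
      (affine-combination slope intercept μ v ∑μ≈1)
      (sum-cong-≋ (λ i → *-congˡ (sym (expansion (v i))))))

  open IsAffine

  apply-isAffine : ∀ {n m} (f : AffineMap n m) i → IsAffine (λ x → apply f x i)
  apply-isAffine f i = record
    { slope = AffineMap.linear f i ; intercept = AffineMap.offset f i ; expansion = λ _ → refl }

  module _ {n p} (S : Pred (Space n) p) where

    ⊆Conv : ∀ {x} → x ∈ S → x ∈ Conv S
    ⊆Conv {x} x∈S = 1 , (λ _ → 1#) , (λ _ → x) , (λ _ → x∈S) , (λ _ → 0≤1) , +-identityʳ 1# ,
      λ j → sym (trans (+-identityʳ _) (*-identityˡ (x j)))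

    apply-Conv : ∀ {m q} (T : Pred (Space m) q) (f : AffineMap n m) →
                 (∀ x → x ∈ S → apply f x ∈ T) → ∀ x → x ∈ Conv S → apply f x ∈ Conv T
    apply-Conv T f S→T x (k , μ , v , v∈S , 0≤μ , ∑μ≈1 , x≈) =
      k , μ , (λ i → apply f (v i)) , (λ i → S→T (v i) (v∈S i)) , 0≤μ , ∑μ≈1 , λ j →
      trans (respects (apply-isAffine f j) x≈) (on-combination (apply-isAffine f j) μ v ∑μ≈1)

    Conv-nonneg : ∀ {φ} → IsAffine φ → (∀ x → x ∈ S → 0# ≤ φ x) → ∀ x → x ∈ Conv S → 0# ≤ φ x
    Conv-nonneg {φ} aff 0≤φ x (k , μ , v , v∈S , 0≤μ , ∑μ≈1 , x≈) =
      respʳ (sym (trans (respects aff x≈) (on-combination aff μ v ∑μ≈1)))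
        (∑-nonneg (λ i → μ i * φ (v i)) (λ i → *-nonneg (0≤μ i) (0≤φ (v i) (v∈S i))))

    Aff-constant : ∀ {φ} b → IsAffine φ → (∀ x → x ∈ S → φ x ≈ b) → ∀ x → x ∈ Aff S → φ x ≈ b
    Aff-constant {φ} b aff φ≈b x (k , μ , v , v∈S , ∑μ≈1 , x≈) = begin
      φ x                          ≈⟨ trans (respects aff x≈) (on-combination aff μ v ∑μ≈1) ⟩
      ∑[ i < k ] (μ i * φ (v i))   ≈⟨ sum-cong-≋ (λ i → *-congˡ (φ≈b (v i) (v∈S i))) ⟩
      ∑[ i < k ] (μ i * b)         ≈⟨ *-distribʳ-sum b μ ⟨
      (∑[ i < k ] μ i) * b         ≈⟨ trans (*-congʳ ∑μ≈1) (*-identityˡ b) ⟩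
      b                            ∎

  Conv-vertices-nonneg : ∀ {n k φ} (v : Vector (Vector ℤ n) k) → IsAffine φ →
    (∀ i → 0# ≤ φ (fromℤⁿ (v i))) → ∀ x → x ∈ Conv ⟦ v ⟧ → 0# ≤ φ x
  Conv-vertices-nonneg v aff 0≤φ = Conv-nonneg ⟦ v ⟧ aff
    (λ x (i , x≈) → respʳ (sym (respects aff x≈)) (0≤φ i))

  -- Inequalities of the two faces

  triangleVertices : Vector (Vector ℤ 2) 3
  triangleVertices = (0ℤ ∷ 0ℤ ∷ []) ∷ (+ 2 ∷ 0ℤ ∷ []) ∷ (0ℤ ∷ + 2 ∷ []) ∷ []

  intervalVertices : ℕ → Vector (Vector ℤ 1) 2
  intervalVertices N = (0ℤ ∷ []) ∷ (+ N ∷ []) ∷ []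

  -- The generating set whose hull `freeJoin 2Δ₂ (interval N)` is by computation, as 2 + 1 + 1
  -- reduces to 4.
  JoinedFaces : ℕ → Pred (Space 4) (c ⊔ ℓ₁ ⊔ ℓ₂)
  JoinedFaces N =
      (λ z → ∃[ x ] x ∈ 2Δ₂ × z ≈ᵥ (x ++ replicate 1 0#) ++ (0# ∷ []))
    ∪ (λ z → ∃[ y ] y ∈ interval N × z ≈ᵥ (replicate 2 0# ++ y) ++ (1# ∷ []))

  -- Each of the three functionals is affine, so its values at the vertices (0,0), (2,0), (0,2)
  -- decide; the last one takes the values 2, 0, 0.
  2Δ₂-bounds : ∀ x → x ∈ 2Δ₂ → 0# ≤ x 0F × 0# ≤ x 1F × 0# ≤ fromℤ (+ 2) - x 0F - x 1F
  2Δ₂-bounds x x∈ =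
      Conv-vertices-nonneg triangleVertices (record
        { slope = fromℤ 1ℤ ∷ 0# ∷ [] ; intercept = 0# ; expansion = λ x →
          solve 2 (λ x y → x := (con 1ℤ :* x :+ (con 0ℤ :* y :+ con 0ℤ)) :+ con 0ℤ) refl (x 0F) (x 1F) })
        (λ { 0F → fromℕ-nonneg 0 ; 1F → fromℕ-nonneg 2 ; 2F → fromℕ-nonneg 0 }) x x∈
    , Conv-vertices-nonneg triangleVertices (record
        { slope = 0# ∷ fromℤ 1ℤ ∷ [] ; intercept = 0# ; expansion = λ x →
          solve 2 (λ x y → y := (con 0ℤ :* x :+ (con 1ℤ :* y :+ con 0ℤ)) :+ con 0ℤ) refl (x 0F) (x 1F) })
        (λ { 0F → fromℕ-nonneg 0 ; 1F → fromℕ-nonneg 0 ; 2F → fromℕ-nonneg 2 }) x x∈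
    , Conv-vertices-nonneg triangleVertices (record
        { slope = fromℤ -1ℤ ∷ fromℤ -1ℤ ∷ [] ; intercept = fromℤ (+ 2) ; expansion = λ x →
          solve 2 (λ x y → con (+ 2) :- x :- y := (con -1ℤ :* x :+ (con -1ℤ :* y :+ con 0ℤ)) :+ con (+ 2)) refl (x 0F) (x 1F) })
        (λ { 0F → respʳ (solve 0 (con (+ 2) := con (+ 2) :- con 0ℤ :- con 0ℤ) refl) (fromℕ-nonneg 2)
           ; 1F → respʳ (solve 0 (con 0ℤ := con (+ 2) :- con (+ 2) :- con 0ℤ) refl) (fromℕ-nonneg 0)
           ; 2F → respʳ (solve 0 (con 0ℤ := con (+ 2) :- con 0ℤ :- con (+ 2)) refl) (fromℕ-nonneg 0) }) x x∈

  interval-bounds : ∀ N y → y ∈ interval N → 0# ≤ y 0F × 0# ≤ fromℤ (+ N) - y 0F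
  interval-bounds N y y∈ =
      Conv-vertices-nonneg (intervalVertices N) (record
        { slope = fromℤ 1ℤ ∷ [] ; intercept = 0# ; expansion = λ y →
          solve 1 (λ y → y := (con 1ℤ :* y :+ con 0ℤ) :+ con 0ℤ) refl (y 0F) })
        (λ { 0F → fromℕ-nonneg 0 ; 1F → fromℕ-nonneg N }) y y∈
    , Conv-vertices-nonneg (intervalVertices N) (record
        { slope = fromℤ -1ℤ ∷ [] ; intercept = fromℤ (+ N) ; expansion = λ y →
          solve 2 (λ n y → n :- y := (con -1ℤ :* y :+ con 0ℤ) :+ n) refl (fromℤ (+ N)) (y 0F) })
        (λ { 0F → respʳ (solve 1 (λ n → n := n :- con 0ℤ) refl _) (fromℕ-nonneg N)
           ; 1F → respʳ (sym (-‿inverseʳ _)) (fromℕ-nonneg 0) }) y y∈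

  -- The isomorphism between the simplex and the free join

  module Simplex (N M : ℕ) (N≡M*2 : N ≡ M ℕ.* 2) .{{_ : NonZero N}} where
    open Codes N M N≡M*2 using (N≡; IsWord; word-multiples; fromWord; fromWord-isWord)

    n m two u : Carrier
    n = fromℤ (+ N)
    m = fromℤ (+ M)
    two = fromℤ (+ 2)
    u = proj₁ (inverse n (fromℕ≉0 N))

    n*u≈1 : n * u ≈ 1#
    n*u≈1 = proj₂ (inverse n (fromℕ≉0 N))

    0≤u : 0# ≤ u
    0≤u = inverse-nonneg (fromℕ-nonneg N) n*u≈1

    n≈m*two : n ≈ m * two
    n≈m*two = trans (reflexive (≡.cong fromℤ N≡)) (fromℤ-* (+ M) (+ 2))

    cancel : ∀ x → n * (u * x) ≈ x
    cancel x = trans (sym (*-assoc n u x)) (trans (*-congʳ n*u≈1) (*-identityˡ x))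

    n-cancel : ∀ x → u * (n * x) ≈ x
    n-cancel x = trans (solve 3 (λ n u x → u :* (n :* x) := n :* (u :* x)) refl n u x) (cancel x)

    -- Here 2u = 2/N is the inverse of M, because M·2·u = N·u = 1.
    m-cancelˡ : ∀ x → m * (two * u * x) ≈ x
    m-cancelˡ x = begin
      m * (two * u * x)   ≈⟨ solve 4 (λ m t u x → m :* (t :* u :* x) := m :* t :* (u :* x)) refl m two u x ⟩
      m * two * (u * x)   ≈⟨ *-congʳ n≈m*two ⟨
      n * (u * x)         ≈⟨ cancel x ⟩
      x                   ∎

    m-cancelʳ : ∀ x → two * u * (m * x) ≈ x
    m-cancelʳ x = trans
      (solve 4 (λ m t u x → t :* u :* (m :* x) := m :* (t :* u :* x)) refl m two u x) (m-cancelˡ x)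

    total-of : Space 5 → Carrier
    total-of x = x 0F + x 1F + x 2F + x 3F + x 4F

    total-of-isAffine : IsAffine total-of
    total-of-isAffine = record
      { slope = λ _ → fromℤ 1ℤ ; intercept = 0# ; expansion = λ x →
        solve 5 (λ x₀ x₁ x₂ x₃ x₄ → x₀ :+ x₁ :+ x₂ :+ x₃ :+ x₄ :=
            (con 1ℤ :* x₀ :+ (con 1ℤ :* x₁ :+ (con 1ℤ :* x₂ :+ (con 1ℤ :* x₃ :+ (con 1ℤ :* x₄ :+ con 0ℤ))))) :+ con 0ℤ)
          refl (x 0F) (x 1F) (x 2F) (x 3F) (x 4F) }

    total-of-basis : ∀ x → x ∈ ⟦ dilatedBasis N ⟧ → total-of x ≈ n
    total-of-basis x (i , x≈) = trans (respects total-of-isAffine x≈) (at i)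
      where
      at : ∀ i → total-of (fromℤⁿ (dilatedBasis N i)) ≈ n
      -- For a concrete index the entries of `dilatedBasis` compute to N or 0.
      at 0F = solve 1 (λ n → n :+ con 0ℤ :+ con 0ℤ :+ con 0ℤ :+ con 0ℤ := n) refl n
      at 1F = solve 1 (λ n → con 0ℤ :+ n :+ con 0ℤ :+ con 0ℤ :+ con 0ℤ := n) refl n
      at 2F = solve 1 (λ n → con 0ℤ :+ con 0ℤ :+ n :+ con 0ℤ :+ con 0ℤ := n) refl n
      at 3F = solve 1 (λ n → con 0ℤ :+ con 0ℤ :+ con 0ℤ :+ n :+ con 0ℤ := n) refl n
      at 4F = solve 1 (λ n → con 0ℤ :+ con 0ℤ :+ con 0ℤ :+ con 0ℤ :+ n := n) refl n

    -- The barycentric coordinates xᵢ/N with respect to N e₀, ..., N e₄. They sum to 1 on the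
    -- hyperplane ∑ xᵢ = N and are nonnegative when x is.
    weights : Space 5 → Vector Carrier 5
    weights x i = u * x i

    vertices : Vector (Space 5) 5
    vertices i = fromℤⁿ (dilatedBasis N i)

    vertices∈ : ∀ i → vertices i ∈ ⟦ dilatedBasis N ⟧
    vertices∈ i = i , λ _ → refl

    ∑weights≈1 : ∀ x → total-of x ≈ n → ∑[ i < 5 ] weights x i ≈ 1#
    ∑weights≈1 x total≈n = begin
      ∑[ i < 5 ] weights x i ≈⟨
        solve 6 (λ u x₀ x₁ x₂ x₃ x₄ →
            u :* x₀ :+ (u :* x₁ :+ (u :* x₂ :+ (u :* x₃ :+ (u :* x₄ :+ con 0ℤ)))) :=
            u :* (x₀ :+ x₁ :+ x₂ :+ x₃ :+ x₄))
          refl u (x 0F) (x 1F) (x 2F) (x 3F) (x 4F) ⟩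
      u * total-of x   ≈⟨ trans (*-congˡ total≈n) (*-comm u n) ⟩
      n * u            ≈⟨ n*u≈1 ⟩
      1#               ∎

    weights-combination : ∀ x → x ≈ᵥ combination (weights x) vertices
    weights-combination x j = trans (sym (cancel (x j))) (at j)
      where
      at : ∀ j → n * (u * x j) ≈ combination (weights x) vertices j
      at 0F = solve 7 (λ n u x₀ x₁ x₂ x₃ x₄ → n :* (u :* x₀) :=
        u :* x₀ :* n :+ (u :* x₁ :* con 0ℤ :+ (u :* x₂ :* con 0ℤ :+ (u :* x₃ :* con 0ℤ :+ (u :* x₄ :* con 0ℤ :+ con 0ℤ)))))
        refl n u (x 0F) (x 1F) (x 2F) (x 3F) (x 4F)
      at 1F = solve 7 (λ n u x₀ x₁ x₂ x₃ x₄ → n :* (u :* x₁) :=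
        u :* x₀ :* con 0ℤ :+ (u :* x₁ :* n :+ (u :* x₂ :* con 0ℤ :+ (u :* x₃ :* con 0ℤ :+ (u :* x₄ :* con 0ℤ :+ con 0ℤ)))))
        refl n u (x 0F) (x 1F) (x 2F) (x 3F) (x 4F)
      at 2F = solve 7 (λ n u x₀ x₁ x₂ x₃ x₄ → n :* (u :* x₂) :=
        u :* x₀ :* con 0ℤ :+ (u :* x₁ :* con 0ℤ :+ (u :* x₂ :* n :+ (u :* x₃ :* con 0ℤ :+ (u :* x₄ :* con 0ℤ :+ con 0ℤ)))))
        refl n u (x 0F) (x 1F) (x 2F) (x 3F) (x 4F)
      at 3F = solve 7 (λ n u x₀ x₁ x₂ x₃ x₄ → n :* (u :* x₃) :=
        u :* x₀ :* con 0ℤ :+ (u :* x₁ :* con 0ℤ :+ (u :* x₂ :* con 0ℤ :+ (u :* x₃ :* n :+ (u :* x₄ :* con 0ℤ :+ con 0ℤ)))))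
        refl n u (x 0F) (x 1F) (x 2F) (x 3F) (x 4F)
      at 4F = solve 7 (λ n u x₀ x₁ x₂ x₃ x₄ → n :* (u :* x₄) :=
        u :* x₀ :* con 0ℤ :+ (u :* x₁ :* con 0ℤ :+ (u :* x₂ :* con 0ℤ :+ (u :* x₃ :* con 0ℤ :+ (u :* x₄ :* n :+ con 0ℤ)))))
        refl n u (x 0F) (x 1F) (x 2F) (x 3F) (x 4F)

    total⇒Aff : ∀ x → total-of x ≈ n → x ∈ Aff ⟦ dilatedBasis N ⟧
    total⇒Aff x total≈n =
      5 , weights x , vertices , vertices∈ , ∑weights≈1 x total≈n , weights-combination x

    nonneg⇒Conv : ∀ x → (∀ i → 0# ≤ x i) → total-of x ≈ n → x ∈ Conv ⟦ dilatedBasis N ⟧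
    nonneg⇒Conv x 0≤x total≈n =
      5 , weights x , vertices , vertices∈ , (λ i → *-nonneg 0≤u (0≤x i)) ,
      ∑weights≈1 x total≈n , weights-combination x

    -- The vertices N e₀, …, N e₄ go to (0,0,0,0), (2,0,0,0), (0,2,0,0), (0,0,0,1), (0,0,N,1).
    toMap : AffineMap 5 4
    toMap = record
      { linear = (0# ∷ two * u ∷ 0#      ∷ 0# ∷ 0#       ∷ [])
               ∷ (0# ∷ 0#      ∷ two * u ∷ 0# ∷ 0#       ∷ [])
               ∷ (0# ∷ 0#      ∷ 0#      ∷ 0# ∷ fromℤ 1ℤ ∷ [])
               ∷ (0# ∷ 0#      ∷ 0#      ∷ u  ∷ u        ∷ [])
               ∷ []
      ; offset = λ _ → 0# }

    fromMap : AffineMap 4 5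
    fromMap = record
      { linear = (- m ∷ - m ∷ 0#         ∷ - n ∷ [])
               ∷ (m   ∷ 0#  ∷ 0#         ∷ 0#  ∷ [])
               ∷ (0#  ∷ m   ∷ 0#         ∷ 0#  ∷ [])
               ∷ (0#  ∷ 0#  ∷ fromℤ -1ℤ  ∷ n   ∷ [])
               ∷ (0#  ∷ 0#  ∷ fromℤ 1ℤ   ∷ 0#  ∷ [])
               ∷ []
      ; offset = n ∷ 0# ∷ 0# ∷ 0# ∷ 0# ∷ [] }

    -- The map of `toMap` without its zero entries; calculations use this form, and `toMap≈` carries
    -- them back to the matrix.
    toFormula : Space 5 → Space 4
    toFormula x = two * u * x 1F ∷ two * u * x 2F ∷ x 4F ∷ u * (x 3F + x 4F) ∷ []

    fromFormula : Space 4 → Space 5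
    fromFormula y = n - m * y 0F - m * y 1F - n * y 3F ∷ m * y 0F ∷ m * y 1F ∷ n * y 3F - y 2F ∷ y 2F ∷ []

    toFormula-cong : ∀ {x y} → x ≈ᵥ y → toFormula x ≈ᵥ toFormula y
    toFormula-cong x≈y 0F = *-congˡ (x≈y 1F)
    toFormula-cong x≈y 1F = *-congˡ (x≈y 2F)
    toFormula-cong x≈y 2F = x≈y 4F
    toFormula-cong x≈y 3F = *-congˡ (+-cong (x≈y 3F) (x≈y 4F))

    fromFormula-cong : ∀ {x y} → x ≈ᵥ y → fromFormula x ≈ᵥ fromFormula y
    fromFormula-cong x≈y 0F = +-cong (+-cong (+-congˡ (-‿cong (*-congˡ (x≈y 0F)))) (-‿cong (*-congˡ (x≈y 1F))))
                                (-‿cong (*-congˡ (x≈y 3F)))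
    fromFormula-cong x≈y 1F = *-congˡ (x≈y 0F)
    fromFormula-cong x≈y 2F = *-congˡ (x≈y 1F)
    fromFormula-cong x≈y 3F = +-cong (*-congˡ (x≈y 3F)) (-‿cong (x≈y 2F))
    fromFormula-cong x≈y 4F = x≈y 2F

    toMap≈ : ∀ x → apply toMap x ≈ᵥ toFormula x
    toMap≈ x 0F = solve 6 (λ k x₀ x₁ x₂ x₃ x₄ →
        (con 0ℤ :* x₀ :+ (k :* x₁ :+ (con 0ℤ :* x₂ :+ (con 0ℤ :* x₃ :+ (con 0ℤ :* x₄ :+ con 0ℤ))))) :+ con 0ℤ
          := k :* x₁) refl (two * u) (x 0F) (x 1F) (x 2F) (x 3F) (x 4F)
    toMap≈ x 1F = solve 6 (λ k x₀ x₁ x₂ x₃ x₄ →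
        (con 0ℤ :* x₀ :+ (con 0ℤ :* x₁ :+ (k :* x₂ :+ (con 0ℤ :* x₃ :+ (con 0ℤ :* x₄ :+ con 0ℤ))))) :+ con 0ℤ
          := k :* x₂) refl (two * u) (x 0F) (x 1F) (x 2F) (x 3F) (x 4F)
    toMap≈ x 2F = solve 5 (λ x₀ x₁ x₂ x₃ x₄ →
        (con 0ℤ :* x₀ :+ (con 0ℤ :* x₁ :+ (con 0ℤ :* x₂ :+ (con 0ℤ :* x₃ :+ (con 1ℤ :* x₄ :+ con 0ℤ))))) :+ con 0ℤ
          := x₄) refl (x 0F) (x 1F) (x 2F) (x 3F) (x 4F)
    toMap≈ x 3F = solve 6 (λ k x₀ x₁ x₂ x₃ x₄ →
        (con 0ℤ :* x₀ :+ (con 0ℤ :* x₁ :+ (con 0ℤ :* x₂ :+ (k :* x₃ :+ (k :* x₄ :+ con 0ℤ))))) :+ con 0ℤ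
          := k :* (x₃ :+ x₄)) refl u (x 0F) (x 1F) (x 2F) (x 3F) (x 4F)

    fromMap≈ : ∀ y → apply fromMap y ≈ᵥ fromFormula y
    fromMap≈ y 0F = solve 6 (λ n m y₀ y₁ y₂ y₃ →
        ((:- m) :* y₀ :+ ((:- m) :* y₁ :+ (con 0ℤ :* y₂ :+ ((:- n) :* y₃ :+ con 0ℤ)))) :+ n
          := n :- m :* y₀ :- m :* y₁ :- n :* y₃) refl n m (y 0F) (y 1F) (y 2F) (y 3F)
    fromMap≈ y 1F = solve 5 (λ m y₀ y₁ y₂ y₃ →
        (m :* y₀ :+ (con 0ℤ :* y₁ :+ (con 0ℤ :* y₂ :+ (con 0ℤ :* y₃ :+ con 0ℤ)))) :+ con 0ℤ
          := m :* y₀) refl m (y 0F) (y 1F) (y 2F) (y 3F)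
    fromMap≈ y 2F = solve 5 (λ m y₀ y₁ y₂ y₃ →
        (con 0ℤ :* y₀ :+ (m :* y₁ :+ (con 0ℤ :* y₂ :+ (con 0ℤ :* y₃ :+ con 0ℤ)))) :+ con 0ℤ
          := m :* y₁) refl m (y 0F) (y 1F) (y 2F) (y 3F)
    fromMap≈ y 3F = solve 5 (λ n y₀ y₁ y₂ y₃ →
        (con 0ℤ :* y₀ :+ (con 0ℤ :* y₁ :+ (con -1ℤ :* y₂ :+ (n :* y₃ :+ con 0ℤ)))) :+ con 0ℤ
          := n :* y₃ :- y₂) refl n (y 0F) (y 1F) (y 2F) (y 3F)
    fromMap≈ y 4F = solve 4 (λ y₀ y₁ y₂ y₃ →
        (con 0ℤ :* y₀ :+ (con 0ℤ :* y₁ :+ (con 1ℤ :* y₂ :+ (con 0ℤ :* y₃ :+ con 0ℤ)))) :+ con 0ℤ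
          := y₂) refl (y 0F) (y 1F) (y 2F) (y 3F)

    -- Each column of the matrix of `fromMap` sums to 0 and the offsets sum to N, so all of K⁴ lands
    -- in the hyperplane.
    total-of-fromMap : ∀ y → total-of (apply fromMap y) ≈ n
    total-of-fromMap y = trans (respects total-of-isAffine (fromMap≈ y))
      (solve 6 (λ n m y₀ y₁ y₂ y₃ →
          (n :- m :* y₀ :- m :* y₁ :- n :* y₃) :+ m :* y₀ :+ m :* y₁ :+ (n :* y₃ :- y₂) :+ y₂ := n)
        refl n m (y 0F) (y 1F) (y 2F) (y 3F))

    toMap∘fromMap : ∀ y → apply toMap (apply fromMap y) ≈ᵥ y
    toMap∘fromMap y j = trans (toMap≈ (apply fromMap y) j)
      (trans (toFormula-cong (fromMap≈ y) j) (at j))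
      where
      at : toFormula (fromFormula y) ≈ᵥ y
      at 0F = m-cancelʳ (y 0F)
      at 1F = m-cancelʳ (y 1F)
      at 2F = refl
      at 3F = trans (*-congˡ (solve 3 (λ n y₂ y₃ → (n :* y₃ :- y₂) :+ y₂ := n :* y₃) refl n (y 2F) (y 3F)))
                (n-cancel (y 3F))

    -- `toMap` forgets x₀; the hypothesis on the sum recovers it as N - x₁ - x₂ - (x₃ + x₄).
    fromMap∘toMap : ∀ x → total-of x ≈ n → apply fromMap (apply toMap x) ≈ᵥ x
    fromMap∘toMap x total≈n j = trans (fromMap≈ (apply toMap x) j)
      (trans (fromFormula-cong (toMap≈ x) j) (at j))
      where
      at : fromFormula (toFormula x) ≈ᵥ x
      at 0F = begin
        n - m * (two * u * x 1F) - m * (two * u * x 2F) - n * (u * (x 3F + x 4F))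
          ≈⟨ +-cong (+-cong (+-cong (sym total≈n) (-‿cong (m-cancelˡ (x 1F))))
                    (-‿cong (m-cancelˡ (x 2F)))) (-‿cong (cancel (x 3F + x 4F))) ⟩
        total-of x - x 1F - x 2F - (x 3F + x 4F)
          ≈⟨ solve 5 (λ x₀ x₁ x₂ x₃ x₄ →
               (x₀ :+ x₁ :+ x₂ :+ x₃ :+ x₄) :- x₁ :- x₂ :- (x₃ :+ x₄) := x₀)
               refl (x 0F) (x 1F) (x 2F) (x 3F) (x 4F) ⟩
        x 0F ∎
      at 1F = m-cancelˡ (x 1F)
      at 2F = m-cancelˡ (x 2F)
      at 3F = trans (+-congʳ (cancel (x 3F + x 4F)))
        (solve 2 (λ x₃ x₄ → (x₃ :+ x₄) :- x₄ := x₃) refl (x 3F) (x 4F))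
      at 4F = refl

    -- The factors 2/N and 1/N cancel the multiples of M and N found in `word-multiples`; the entry
    -- w₄ is copied.
    toMap-integral : ∀ w → IsWord w → ∃[ z ] toFormula (fromℤⁿ w) ≈ᵥ fromℤⁿ z
    toMap-integral w isWord with word-multiples w isWord
    ... | p , q , t , w₁≡ , w₂≡ , w₃₄≡ = (p ∷ q ∷ w 4F ∷ t ∷ []) , λ
      { 0F → half w₁≡
      ; 1F → half w₂≡
      ; 2F → refl
      ; 3F → trans (*-congˡ (trans (sym (fromℤ-+ (w 3F) (w 4F)))
                 (trans (reflexive (≡.cong fromℤ w₃₄≡)) (fromℤ-* (+ N) t)))) (n-cancel (fromℤ t)) }
      where
      half : ∀ {x p} → x ≡ + M ℤ.* p → two * u * fromℤ x ≈ fromℤ p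
      half {x} {p} x≡ = trans (*-congˡ (trans (reflexive (≡.cong fromℤ x≡)) (fromℤ-* (+ M) p)))
                      (m-cancelʳ (fromℤ p))

    fromFormula-fromℤⁿ : ∀ z → fromFormula (fromℤⁿ z) ≈ᵥ fromℤⁿ (fromWord z)
    fromFormula-fromℤⁿ z = λ
      { 0F → sym (trans (fromℤ-minus (+ N ℤ.- + M ℤ.* z 0F ℤ.- + M ℤ.* z 1F) (+ N ℤ.* z 3F)) (+-cong
               (trans (fromℤ-minus (+ N ℤ.- + M ℤ.* z 0F) (+ M ℤ.* z 1F)) (+-cong
                 (trans (fromℤ-minus (+ N) (+ M ℤ.* z 0F)) (+-congˡ (-‿cong (fromℤ-* (+ M) (z 0F)))))
                 (-‿cong (fromℤ-* (+ M) (z 1F)))))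
               (-‿cong (fromℤ-* (+ N) (z 3F)))))
      ; 1F → sym (fromℤ-* (+ M) (z 0F))
      ; 2F → sym (fromℤ-* (+ M) (z 1F))
      ; 3F → sym (trans (fromℤ-minus (+ N ℤ.* z 3F) (z 2F)) (+-congʳ (fromℤ-* (+ N) (z 3F))))
      ; 4F → refl }
      where
      fromℤ-minus : ∀ x y → fromℤ (x ℤ.- y) ≈ fromℤ x - fromℤ y
      fromℤ-minus x y = trans (fromℤ-+ x (ℤ.- y)) (+-congˡ (fromℤ-neg y))

    -- Affine maps carry hulls to hulls, so only the five vertices have to be placed: the first
    -- three at the vertices of 2Δ₂ at height 0, the last two at the ends of the interval at height
    -- 1.
    toMap-freeJoin : ∀ x → x ∈ Conv ⟦ dilatedBasis N ⟧ → apply toMap x ∈ freeJoin 2Δ₂ (interval N)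
    toMap-freeJoin = apply-Conv ⟦ dilatedBasis N ⟧ (JoinedFaces N) toMap λ x (i , x≈) →
      vertex i (λ j → trans (toMap≈ x j) (toFormula-cong x≈ j))
      where
      in₂ : ∀ i → fromℤⁿ (triangleVertices i) ∈ 2Δ₂
      in₂ i = ⊆Conv ⟦ triangleVertices ⟧ (i , λ _ → refl)
      in₁ : ∀ i → fromℤⁿ (intervalVertices N i) ∈ interval N
      in₁ i = ⊆Conv ⟦ intervalVertices N ⟧ (i , λ _ → refl)
      2un≈2 : two * u * n ≈ two
      2un≈2 = trans (solve 3 (λ t u n → t :* u :* n := n :* (u :* t)) refl two u n) (cancel two)
      u[0+0]≈0 : u * (0# + 0#) ≈ 0#
      u[0+0]≈0 = trans (*-congˡ (+-identityˡ 0#)) (zeroʳ u)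
      un≈1 : u * n ≈ 1#
      un≈1 = trans (*-comm u n) n*u≈1
      vertex : ∀ i {y} → y ≈ᵥ toFormula (vertices i) → y ∈ JoinedFaces N
      vertex 0F y≈ = inj₁ (fromℤⁿ (triangleVertices 0F) , in₂ 0F , λ
        { 0F → trans (y≈ 0F) (zeroʳ _) ; 1F → trans (y≈ 1F) (zeroʳ _)
        ; 2F → y≈ 2F ; 3F → trans (y≈ 3F) u[0+0]≈0 })
      vertex 1F y≈ = inj₁ (fromℤⁿ (triangleVertices 1F) , in₂ 1F , λ
        { 0F → trans (y≈ 0F) 2un≈2 ; 1F → trans (y≈ 1F) (zeroʳ _)
        ; 2F → y≈ 2F ; 3F → trans (y≈ 3F) u[0+0]≈0 })
      vertex 2F y≈ = inj₁ (fromℤⁿ (triangleVertices 2F) , in₂ 2F , λ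
        { 0F → trans (y≈ 0F) (zeroʳ _) ; 1F → trans (y≈ 1F) 2un≈2
        ; 2F → y≈ 2F ; 3F → trans (y≈ 3F) u[0+0]≈0 })
      vertex 3F y≈ = inj₂ (fromℤⁿ (intervalVertices N 0F) , in₁ 0F , λ
        { 0F → trans (y≈ 0F) (zeroʳ _) ; 1F → trans (y≈ 1F) (zeroʳ _)
        ; 2F → y≈ 2F ; 3F → trans (y≈ 3F) (trans (*-congˡ (+-identityʳ n)) un≈1) })
      vertex 4F y≈ = inj₂ (fromℤⁿ (intervalVertices N 1F) , in₁ 1F , λ
        { 0F → trans (y≈ 0F) (zeroʳ _) ; 1F → trans (y≈ 1F) (zeroʳ _)
        ; 2F → y≈ 2F ; 3F → trans (y≈ 3F) (trans (*-congˡ (+-identityˡ n)) un≈1) })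

    -- The five coordinates of `fromMap` are affine, so their signs are checked on the two faces. At
    -- (x, 0, 0) they are M(2 - x₀ - x₁), Mx₀, Mx₁, 0, 0, and at (0, 0, y, 1) they are 0, 0, 0, N -
    -- y, y.
    fromMap-Conv : ∀ y → y ∈ freeJoin 2Δ₂ (interval N) → apply fromMap y ∈ Conv ⟦ dilatedBasis N ⟧
    fromMap-Conv y y∈ = nonneg⇒Conv (apply fromMap y)
      (λ i → Conv-nonneg (JoinedFaces N) (apply-isAffine fromMap i) (λ z z∈ → facet z z∈ i) y y∈)
      (total-of-fromMap y)
      where
      0≤0 : 0# ≤ 0#
      0≤0 = fromℕ-nonneg 0
      0≤m : 0# ≤ m
      0≤m = fromℕ-nonneg M
      facet : ∀ z → z ∈ JoinedFaces N → ∀ i → 0# ≤ apply fromMap z i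
      facet z (inj₁ (x , x∈ , z≈)) i = respʳ (sym (trans (fromMap≈ z i) (fromFormula-cong z≈ i))) (at i)
        where
        bounds = 2Δ₂-bounds x x∈
        at : ∀ i → 0# ≤ fromFormula ((x ++ replicate 1 0#) ++ (0# ∷ [])) i
        -- By N = 2M this coordinate is M times the third bound of `2Δ₂-bounds`.
        at 0F = respʳ
          (trans (solve 4 (λ m t x₀ x₁ → m :* (t :- x₀ :- x₁) := m :* t :- m :* x₀ :- m :* x₁)
                   refl m two (x 0F) (x 1F))
            (trans (+-congʳ (+-congʳ (sym n≈m*two)))
              (solve 4 (λ n m x₀ x₁ → n :- m :* x₀ :- m :* x₁ := n :- m :* x₀ :- m :* x₁ :- n :* con 0ℤ)
                refl n m (x 0F) (x 1F))))
          (*-nonneg 0≤m (proj₂ (proj₂ bounds)))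
        at 1F = *-nonneg 0≤m (proj₁ bounds)
        at 2F = *-nonneg 0≤m (proj₁ (proj₂ bounds))
        at 3F = respʳ (solve 1 (λ n → con 0ℤ := n :* con 0ℤ :- con 0ℤ) refl n) 0≤0
        at 4F = 0≤0
      facet z (inj₂ (x , x∈ , z≈)) i = respʳ (sym (trans (fromMap≈ z i) (fromFormula-cong z≈ i))) (at i)
        where
        bounds = interval-bounds N x x∈
        at : ∀ i → 0# ≤ fromFormula ((replicate 2 0# ++ x) ++ (1# ∷ [])) i
        at 0F = respʳ
          (trans (solve 2 (λ n m → con 0ℤ := n :- m :* con 0ℤ :- m :* con 0ℤ :- n) refl n m)
            (+-congˡ (-‿cong (sym (*-identityʳ n))))) 0≤0
        at 1F = respʳ (sym (zeroʳ m)) 0≤0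
        at 2F = respʳ (sym (zeroʳ m)) 0≤0
        at 3F = respʳ (+-congʳ (sym (*-identityʳ n))) (proj₂ bounds)
        at 4F = proj₁ bounds

    -- The code enters only through `IsWord`, so one construction serves both generator matrices.
    simplex≅freeJoin : ∀ (C : Code N 5) z → (∀ w → w ∈ words C ⇔ IsWord w) →
                       UnimodularIso (simplex C z) (standard (freeJoin 2Δ₂ (interval N)))
    simplex≅freeJoin C z C⇔word = record
      { to = toMap
      ; from = fromMap
      -- The coordinate sum is N on the affine hull of the vertices, hence on the lattice inside it,
      -- hence on the affine hull of the lattice.
      ; from∘to = λ x x∈ → fromMap∘toMap x (Aff-constant (lattice (simplex C z)) n total-of-isAffine
          (λ y (y∈Aff , _) → Aff-constant ⟦ dilatedBasis N ⟧ n total-of-isAffine total-of-basis y y∈Aff) x x∈)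
      ; to∘from = λ y _ → toMap∘fromMap y
      ; to-lattice = λ x (_ , w , w∈C , x≈) →
          let z , w≈z = toMap-integral w (Equivalence.to (C⇔word w) w∈C)
          in z , _ , λ j → trans (toMap≈ x j) (trans (toFormula-cong x≈ j) (w≈z j))
      ; from-lattice = λ y (z , _ , y≈) →
          total⇒Aff (apply fromMap y) (total-of-fromMap y) ,
          fromWord z , Equivalence.from (C⇔word _) (fromWord-isWord z) , λ j →
          trans (fromMap≈ y j) (trans (fromFormula-cong y≈ j) (fromFormula-fromℤⁿ z j))
      ; to-polytope = toMap-freeJoin
      ; from-polytope = fromMap-Conv
      }

-- Assembling the four claims

lcm[2,N]≡N : ∀ {N} → 2 ∣ N → lcm 2 N ≡ N
lcm[2,N]≡N {N} 2∣N = ∣-antisym (lcm-least 2∣N ∣-refl) (n∣lcm[m,n] 2 N)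

open import Data.Nat.Base using (_≤_)

lemma3p10 : ∀ {c ℓ₁ ℓ₂} (K : OrderedField c ℓ₁ ℓ₂) (N : ℕ) .{{_ : NonZero N}} (a : ℤ) →
  2 ≤ N → 2 ∣ N → ¬ (+ 2 ∣ℤ a) →
  let open Polytopes K
      M₂ = N / 2
      C  = span N (g M₂ a)
      C₀ = span N (g₀ M₂)
      Δ  = standard (freeJoin 2Δ₂ (interval N))
  in (C ≅ C₀)
   × (Σ[ eq ∈ lcm 2 N ≡ N ] (subst (λ L → Code L 5) eq (span 2 g₁ ⊕ span N g₂) ≋ C₀))
   × (Σ[ z ∈ ZeroSum C ] UnimodularIso (simplex C z) Δ)
   × (Σ[ z ∈ ZeroSum C₀ ] UnimodularIso (simplex C₀ z) Δ)
lemma3p10 K N a _ 2∣N odd =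
    -- Both codes have the same words, so no coordinates need to be moved.
    (Permutation.id , λ w → ⇔-sym (g₀⇔word w) ⇔-∘ g⇔word a odd w)
  , (lcm≡N , λ w → ⇔-sym (g₀⇔word w) ⇔-∘ (⊕⇔word lcm≡N w ⇔-∘ subst-words lcm≡N _ w))
  , (zC , simplex≅freeJoin (span N (g (N / 2) a)) zC (g⇔word a odd))
  , (zC₀ , simplex≅freeJoin (span N (g₀ (N / 2))) zC₀ g₀⇔word)
  where
  lcm≡N : lcm 2 N ≡ N
  lcm≡N = lcm[2,N]≡N 2∣N
  N≡M*2 : N ≡ N / 2 ℕ.* 2
  N≡M*2 = ≡.sym (m/n*n≡m 2∣N)
  open Codes N (N / 2) N≡M*2
  open Field.Simplex K N (N / 2) N≡M*2
  zC : ZeroSum (span N (g (N / 2) a))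
  zC w w∈C = sum-word≈0 w (Equivalence.to (g⇔word a odd w) w∈C)
  zC₀ : ZeroSum (span N (g₀ (N / 2)))
  zC₀ w w∈C₀ = sum-word≈0 w (Equivalence.to (g₀⇔word w) w∈C₀)
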